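{- For any integers $1\le h<k\le n$, the signed $k,h$-equal partition lattice $\Pi^B_{n,k,h}$ is comodernistic.
   Context: A sign pattern on a set is an assignment of $+$ or $-$ to each element, considered up to reversing all signs simultaneously. A signed partition of $\{0,1,\dots,n\}$ is a set partition together with a sign pattern on each block not containing $0$ (the block containing $0$ is the zero block; the others are signed blocks). The signed partition lattice $\Pi^B_n$ consists of all signed partitions; its cover relations are: merging two signed blocks and choosing one of the two sign patterns on the union compatible with the patterns on the two blocks, or merging a signed block into the zero block (forgetting its sign pattern). $\Pi^B_{n,k,h}$ is the subposet of $\Pi^B_n$ of signed partitions whose non-singleton signed blocks have size at least $k$ and whose zero block is either a singleton or has size at least $h+1$. An element $m$ of a lattice $L$ is left-modular if $(x\vee m)\wedge y=x\vee(m\wedge y)$ for all $x<y$; a lattice is comodernistic if every interval $[u,v]$ has a coatom that is left-modular in $[u,v]$. -}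

module Defs where

open import Data.Nat using (ℕ; zero; suc; _≤_)
open import Data.Fin using (Fin) renaming (zero to fzero)
open import Data.Bool using (Bool; T)
open import Data.List using (length; filterᵇ; allFin)
open import Data.Product using (Σ; _×_; ∃)
open import Data.Sum using (_⊎_)
open import Relation.Nullary using (¬_)
open import Relation.Binary.PropositionalEquality using (_≡_)
open import Relation.Binary.Construct.Closure.Transitive using (TransClosure)

Iff : Set → Set → Set
Iff A B = (A → B) × (B → A)

-- Signed partitions of {0,1,...,n}; ground set is Fin (suc n), 0 = fzero.
-- blk i j  : i and j lie in the same block (an equivalence relation).
-- sign     : a sign (true = +, false = -) for every element; only its
--            restriction to each signed block matters, and only up to
--            global reversal on that block (see _≈_ below).  Signs of
--            elements of the zero block are ignored.

record SignedPartition (n : ℕ) : Set where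
  field
    blk       : Fin (suc n) → Fin (suc n) → Bool
    sign      : Fin (suc n) → Bool
    blk-refl  : ∀ i → T (blk i i)
    blk-sym   : ∀ i j → T (blk i j) → T (blk j i)
    blk-trans : ∀ i j l → T (blk i j) → T (blk j l) → T (blk i l)

open SignedPartition public

module _ {n : ℕ} where

  SameBlock : SignedPartition n → Fin (suc n) → Fin (suc n) → Set
  SameBlock x i j = T (blk x i j)

  InZero : SignedPartition n → Fin (suc n) → Set
  InZero x i = SameBlock x fzero i

  Signed : SignedPartition n → Fin (suc n) → Set
  Signed x i = ¬ InZero x i

  -- i and j carry the same sign (meaningful inside a signed block)
  SameSign : SignedPartition n → Fin (suc n) → Fin (suc n) → Set
  SameSign x i j = sign x i ≡ sign x j

  -- equality of signed partitions: same blocks, and on each signed block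
  -- the same sign pattern up to reversing all signs
  _≈B_ : SignedPartition n → SignedPartition n → Set
  x ≈B y = (∀ i j → Iff (SameBlock x i j) (SameBlock y i j))
         × (∀ i j → SameBlock x i j → Signed x i → Iff (SameSign x i j) (SameSign y i j))

  -- cover (a): merge the signed blocks of a and b, choosing on the union a
  -- sign pattern compatible with the patterns of the two blocks; all other
  -- blocks (with their sign patterns) unchanged.
  MergeSigned : SignedPartition n → SignedPartition n → Fin (suc n) → Fin (suc n) → Set
  MergeSigned x y a b =
    Signed x a × Signed x b × ¬ SameBlock x a b
    × (∀ i j → Iff (SameBlock y i j)
                   (SameBlock x i j ⊎ ((SameBlock x a i × SameBlock x b j) ⊎ (SameBlock x b i × SameBlock x a j))))
    × (∀ i j → SameBlock x i j → Signed x i → Iff (SameSign y i j) (SameSign x i j))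

  -- cover (b): merge the signed block of a into the zero block (forgetting
  -- its sign pattern); all other blocks (with sign patterns) unchanged.
  MergeZero : SignedPartition n → SignedPartition n → Fin (suc n) → Set
  MergeZero x y a =
    Signed x a
    × (∀ i j → Iff (SameBlock y i j)
                   (SameBlock x i j ⊎ ((InZero x i ⊎ SameBlock x a i) × (InZero x j ⊎ SameBlock x a j))))
    × (∀ i j → SameBlock x i j → Signed x i → ¬ SameBlock x a i → Iff (SameSign y i j) (SameSign x i j))

  Cover : SignedPartition n → SignedPartition n → Set
  Cover x y = (Σ (Fin (suc n)) λ a → Σ (Fin (suc n)) λ b → MergeSigned x y a b)
            ⊎ (Σ (Fin (suc n)) λ a → MergeZero x y a)

  _≤B_ : SignedPartition n → SignedPartition n → Set
  x ≤B y = x ≈B y ⊎ TransClosure Cover x y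

  blockSize : SignedPartition n → Fin (suc n) → ℕ
  blockSize x i = length (filterᵇ (blk x i) (allFin (suc n)))

InΠB : (n k h : ℕ) → SignedPartition n → Set
InΠB n k h x =
  (∀ i → Signed x i → (∀ j → SameBlock x i j → j ≡ i) ⊎ k ≤ blockSize x i)
  × ((∀ j → InZero x j → j ≡ fzero) ⊎ suc h ≤ blockSize x fzero)

module Order {A : Set} (_≈_ : A → A → Set) (_≤_ : A → A → Set) where

  _<_ : A → A → Set
  x < y = x ≤ y × ¬ (x ≈ y)

  IsJoinIn : (A → Set) → A → A → A → Set
  IsJoinIn S x y z = S z × x ≤ z × y ≤ z × (∀ w → S w → x ≤ w → y ≤ w → z ≤ w)

  IsMeetIn : (A → Set) → A → A → A → Set
  IsMeetIn S x y z = S z × z ≤ x × z ≤ y × (∀ w → S w → w ≤ x → w ≤ y → w ≤ z)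

  IsLatticeOn : (A → Set) → Set
  IsLatticeOn S = ∀ x y → S x → S y → (∃ λ z → IsJoinIn S x y z) × (∃ λ z → IsMeetIn S x y z)

  Interval : (A → Set) → A → A → A → Set
  Interval S u v x = S x × u ≤ x × x ≤ v

  IsCoatomOf : (A → Set) → A → A → A → Set
  IsCoatomOf S u v m = Interval S u v m × m < v
    × (∀ w → Interval S u v w → m ≤ w → (w ≈ m) ⊎ (w ≈ v))

  IsLeftModularIn : (A → Set) → A → Set
  IsLeftModularIn I m = ∀ x y → I x → I y → x < y →
    ∀ a b c d → IsJoinIn I x m a → IsMeetIn I a y b → IsMeetIn I m y c → IsJoinIn I x c d → b ≈ d

  IsComodernistic : (A → Set) → Set
  IsComodernistic S = ∀ u v → S u → S v → u < v →
    ∃ λ m → IsCoatomOf S u v m × IsLeftModularIn (Interval S u v) m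

ComodernisticLatticeΠB : (n k h : ℕ) → Set
ComodernisticLatticeΠB n k h =
  IsLatticeOn (InΠB n k h) × IsComodernistic (InΠB n k h)
  where open Order (_≈B_ {n}) (_≤B_ {n})

{-# OPTIONS --safe #-}
module Submission where

-- Joins and meets of Π^B_{n,k,h} are those of Π^B_n followed by `prune`, which
-- breaks the blocks of forbidden size into singletons.
-- A coatom m of [u,v] is left-modular as soon as m ∧ y is covered by y for every
-- y ≰ m.  Pick a signed block A of u properly contained in its block B of v,
-- taking a singleton whenever B contains a nonzero singleton block of u, let p
-- have the signed block A and all other elements in the zero block, and put
-- m = prune (v ∧ p).  Suppose prune (y ∧ p) ≤ z ≤ y and z ≰ p, and let C be the
-- block of y containing A.  If C ∖ A has an admissible size, then z joins it
-- to A; otherwise A is a singleton, C has the least admissible size, and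
-- admissibility of z makes C a block of z.  In both cases z = y.

open import Defs
open import Data.Bool using (Bool; true; false; T; _xor_; if_then_else_)
open import Data.Bool.Properties using (xor-comm; xor-same; T?) renaming (_≟_ to _≟ᵇ_)
open import Data.Empty using (⊥-elim)
open import Data.Fin using (Fin) renaming (zero to fzero)
open import Data.Fin.Properties using (any?; _≟_)
open import Data.List using (List; []; _∷_; length; filterᵇ; allFin; cartesianProduct)
open import Data.List.Membership.Propositional using (lose)
open import Data.List.Membership.Propositional.Properties using (∈-allFin; ∈-cartesianProduct⁺)
open import Data.List.Relation.Unary.All as All using (All; []; _∷_)
open import Data.List.Relation.Unary.Any using (Any; here; there)
open import Data.List.Relation.Unary.AllPairs using ([]; _∷_)
open import Data.List.Relation.Unary.Unique.Propositional using (Unique)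
open import Data.List.Relation.Unary.Unique.Propositional.Properties using (allFin⁺)
open import Data.Nat using (ℕ; suc; _≤_; _<_; z≤n; s≤s; _≤?_)
open import Data.Nat.Properties using (≤-refl; ≤-reflexive; ≤-trans; ≤-antisym; m≤n⇒m≤1+n; ≰⇒>; <⇒≱)
open import Data.Product using (Σ; _×_; _,_; proj₁; proj₂; ∃)
open import Data.Sum using (_⊎_; inj₁; inj₂; [_,_]′; map)
open import Function using (_∘_; id)
open import Relation.Binary.Construct.Closure.Transitive using (TransClosure; [_]; _∷_)
open import Relation.Binary.PropositionalEquality using (_≡_; _≢_; refl; sym; trans; cong; cong₂; subst)
open import Relation.Nullary using (¬_; Dec; yes; no; ⌊_⌋; ¬?)
open import Relation.Nullary.Decidable using (toWitness; fromWitness; _×-dec_; _⊎-dec_; decidable-stable)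

-- Counting

module _ {A : Set} {p q : A → Bool} where

  length-filterᵇ-mono : ∀ {xs} → All (λ x → T (p x) → T (q x)) xs →
    length (filterᵇ p xs) ≤ length (filterᵇ q xs)
  length-filterᵇ-mono []               = z≤n
  length-filterᵇ-mono {x ∷ _} (f ∷ fs) with p x | q x
  ... | false | false = length-filterᵇ-mono fs
  ... | false | true  = m≤n⇒m≤1+n (length-filterᵇ-mono fs)
  ... | true  | true  = s≤s (length-filterᵇ-mono fs)
  ... | true  | false = ⊥-elim (f _)

  length-filterᵇ-strict : ∀ {xs} → All (λ x → T (p x) → T (q x)) xs →
    Any (λ x → ¬ T (p x) × T (q x)) xs → length (filterᵇ p xs) < length (filterᵇ q xs)
  length-filterᵇ-strict {x ∷ _} (f ∷ fs) (here (¬px , qx)) with p x | q x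
  ... | false | true  = s≤s (length-filterᵇ-mono fs)
  ... | true  | _     = ⊥-elim (¬px _)
  length-filterᵇ-strict {x ∷ _} (f ∷ fs) (there any) with p x | q x
  ... | false | false = length-filterᵇ-strict fs any
  ... | false | true  = m≤n⇒m≤1+n (length-filterᵇ-strict fs any)
  ... | true  | true  = s≤s (length-filterᵇ-strict fs any)
  ... | true  | false = ⊥-elim (f _)

  length-filterᵇ-insert : ∀ {xs} a → Unique xs → (∀ x → T (p x) → x ≡ a ⊎ T (q x)) →
    length (filterᵇ p xs) ≤ suc (length (filterᵇ q xs))
  length-filterᵇ-insert a []                f = z≤n
  length-filterᵇ-insert {x ∷ xs} a (x∉ ∷ uniq) f with p x | q x | f x
  ... | false | false | _ = length-filterᵇ-insert a uniq f
  ... | false | true  | _ = m≤n⇒m≤1+n (length-filterᵇ-insert a uniq f)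
  ... | true  | true  | _ = s≤s (length-filterᵇ-insert a uniq f)
  ... | true  | false | g with g _
  -- By uniqueness `a` does not recur in the tail, so there `p` implies `q`.
  ... | inj₁ refl = s≤s (length-filterᵇ-mono (All.map (λ x≢y py → [ ⊥-elim ∘ x≢y ∘ sym , id ]′ (f _ py)) x∉))

-- Relative signs

xor-cocycle : ∀ a b c → (a xor b) xor (b xor c) ≡ a xor c
xor-cocycle false false c = refl
xor-cocycle false true  false = refl
xor-cocycle false true  true = refl
xor-cocycle true  false c = refl
xor-cocycle true  true  c = refl

-- The definitions compare sign patterns through equivalences of equalities; as equations between
-- xors, these comparisons compose along chains of elements.
xor≡⇒Iff : ∀ a b c d → a xor b ≡ c xor d → Iff (a ≡ b) (c ≡ d)
xor≡⇒Iff a b c d eq = to eq , to (sym eq)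
  where
  xor≡false : ∀ a b → a xor b ≡ false → a ≡ b
  xor≡false false false _ = refl
  xor≡false true  true  _ = refl

  to : ∀ {a b c d} → a xor b ≡ c xor d → a ≡ b → c ≡ d
  to {a} {c = c} {d} eq refl = xor≡false c d (trans (sym eq) (xor-same a))

Iff⇒xor≡ : ∀ a b c d → Iff (a ≡ b) (c ≡ d) → a xor b ≡ c xor d
Iff⇒xor≡ a b c d (f , g) with a ≟ᵇ b | c ≟ᵇ d
... | yes refl | _        = trans (xor-same a) (sym (trans (cong (c xor_) (sym (f refl))) (xor-same c)))
... | no a≢b   | yes c≡d  = ⊥-elim (a≢b (g c≡d))
... | no a≢b   | no c≢d   = trans (≢⇒xor a b a≢b) (sym (≢⇒xor c d c≢d))
  where
  ≢⇒xor : ∀ a b → a ≢ b → a xor b ≡ true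
  ≢⇒xor false false a≢b = ⊥-elim (a≢b refl)
  ≢⇒xor false true  _   = refl
  ≢⇒xor true  false _   = refl
  ≢⇒xor true  true  a≢b = ⊥-elim (a≢b refl)

-- Links between elements and the order they define

module _ {n : ℕ} where

  private
    E = Fin (suc n)
    SP = SignedPartition n

  -- Reversing all signs of a block leaves this relative sign unchanged, so on a signed block it is
  -- exactly the information that the pattern carries.
  diff : SP → E → E → Bool
  diff x i j = sign x i xor sign x j

  diff-cocycle : ∀ (x : SP) i j l → diff x i j xor diff x j l ≡ diff x i l
  diff-cocycle x i j l = xor-cocycle (sign x i) (sign x j) (sign x l)

  diff-sym : ∀ (x : SP) i j → diff x i j ≡ diff x j i
  diff-sym x i j = xor-comm (sign x i) (sign x j)

  sameBlock? : ∀ (x : SP) i j → Dec (SameBlock x i j)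
  sameBlock? x i j = T? (blk x i j)

  InZero-resp : ∀ (x : SP) i j → SameBlock x i j → InZero x i → InZero x j
  InZero-resp x i j ij 0i = blk-trans x fzero i j 0i ij

  InZero-SameBlock : ∀ (x : SP) i j → InZero x i → InZero x j → SameBlock x i j
  InZero-SameBlock x i j 0i 0j = blk-trans x i fzero j (blk-sym x fzero i 0i) 0j

  -- i and j are joined with relative sign e, or both lie in the zero block.
  Linked : SP → E → E → Bool → Set
  Linked x i j e = SameBlock x i j × (Signed x i → diff x i j ≡ e)

  Linked-sym : ∀ (x : SP) i j {e} → Linked x i j e → Linked x j i e
  Linked-sym x i j (ij , s) = blk-sym x i j ij ,
    λ j∉0 → trans (diff-sym x j i) (s (j∉0 ∘ InZero-resp x i j ij))

  Linked-trans : ∀ (x : SP) i j l {d e} → Linked x i j d → Linked x j l e → Linked x i l (d xor e)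
  Linked-trans x i j l (ij , s) (jl , t) = blk-trans x i j l ij jl ,
    λ i∉0 → trans (sym (diff-cocycle x i j l))
                  (cong₂ _xor_ (s i∉0) (t (i∉0 ∘ InZero-resp x j i (blk-sym x i j ij))))

  Linked-zero : ∀ (x : SP) i j e → InZero x i → InZero x j → Linked x i j e
  Linked-zero x i j e 0i 0j = InZero-SameBlock x i j 0i 0j , λ i∉0 → ⊥-elim (i∉0 0i)

  infix 4 _⊑_

  -- A description of `_≤B_` free of chains; `≤⇒⊑` and `⊑⇒≤` show that the two agree. The sign
  -- condition is tied to signed blocks of `y`, since absorption into the zero block forgets signs.
  record _⊑_ (x y : SP) : Set where
    constructor mk⊑
    field link : ∀ i j → SameBlock x i j → Linked y i j (diff x i j)

    block : ∀ i j → SameBlock x i j → SameBlock y i j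
    block i j = proj₁ ∘ link i j

  open _⊑_

  ⊑-refl : ∀ {x} → x ⊑ x
  ⊑-refl = mk⊑ λ i j ij → ij , λ _ → refl

  Linked-mono : ∀ {x y} → x ⊑ y → ∀ i j {e} → Linked x i j e → Linked y i j e
  Linked-mono x⊑y i j (ij , s) with link x⊑y i j ij
  ... | ij′ , t = ij′ , λ i∉0 → trans (t i∉0) (s (i∉0 ∘ block x⊑y fzero i))

  ⊑-trans : ∀ {x y z} → x ⊑ y → y ⊑ z → x ⊑ z
  ⊑-trans x⊑y y⊑z = mk⊑ λ i j → Linked-mono y⊑z i j ∘ link x⊑y i j

  ⊑-antisym : ∀ {x y} → x ⊑ y → y ⊑ x → x ≈B y
  ⊑-antisym {x} {y} x⊑y y⊑x =
    (λ i j → block x⊑y i j , block y⊑x i j) ,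
    λ i j ij i∉0 → xor≡⇒Iff (sign x i) (sign x j) (sign y i) (sign y j)
      (sym (proj₂ (link x⊑y i j ij) (i∉0 ∘ block y⊑x fzero i)))

  ≈⇒⊑ : ∀ {x y : SP} → x ≈B y → x ⊑ y
  ≈⇒⊑ {x} {y} (b , s) = mk⊑ λ i j ij → proj₁ (b i j) ij , λ i∉0 →
    sym (Iff⇒xor≡ (sign x i) (sign x j) (sign y i) (sign y j) (s i j ij (i∉0 ∘ proj₁ (b fzero i))))

  ≈-sym : ∀ {x y : SP} → x ≈B y → y ≈B x
  ≈-sym (b , s) = (λ i j → proj₂ (b i j) , proj₁ (b i j)) ,
    λ i j ij i∉0 → let (f , g) = s i j (proj₂ (b i j) ij) (i∉0 ∘ proj₁ (b fzero i)) in g , f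

  Cover⇒⊑ : ∀ {x y : SP} → Cover x y → x ⊑ y
  Cover⇒⊑ {x} {y} (inj₁ (a , b , a∉0 , b∉0 , a≁b , B , S)) = mk⊑ λ i j ij →
    proj₂ (B i j) (inj₁ ij) , λ i∉0 →
      Iff⇒xor≡ (sign y i) (sign y j) (sign x i) (sign x j) (S i j ij (i∉0 ∘ proj₂ (B fzero i) ∘ inj₁))
  Cover⇒⊑ {x} {y} (inj₂ (a , a∉0 , B , S)) = mk⊑ λ i j ij →
    proj₂ (B i j) (inj₁ ij) , λ i∉0 →
      Iff⇒xor≡ (sign y i) (sign y j) (sign x i) (sign x j)
        (S i j ij (i∉0 ∘ proj₂ (B fzero i) ∘ inj₁)
           (λ ai → i∉0 (proj₂ (B fzero i) (inj₂ (inj₁ (blk-refl x fzero) , inj₂ ai)))))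

  ≤⇒⊑ : ∀ {x y : SP} → x ≤B y → x ⊑ y
  ≤⇒⊑ (inj₁ x≈y)       = ≈⇒⊑ x≈y
  ≤⇒⊑ (inj₂ [ c ])     = Cover⇒⊑ c
  ≤⇒⊑ (inj₂ (c ∷ cs))  = ⊑-trans (Cover⇒⊑ c) (≤⇒⊑ (inj₂ cs))

  private
    _⇔∘_ : ∀ {A B C : Set} → Iff A B → Iff B C → Iff A C
    (f , g) ⇔∘ (f′ , g′) = f′ ∘ f , g ∘ g′

  -- Joins are determined only up to `_≈B_`, so a chain that ends at a join may need its last cover
  -- redirected.
  Cover-respʳ-≈ : ∀ {x y z : SP} → Cover x y → y ≈B z → Cover x z
  Cover-respʳ-≈ {x} {y} {z} (inj₁ (a , b , a∉0 , b∉0 , a≁b , B , S)) y≈z =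
    inj₁ (a , b , a∉0 , b∉0 , a≁b ,
      (λ i j → proj₁ (≈-sym {y} {z} y≈z) i j ⇔∘ B i j) ,
      λ i j ij i∉0 →
        let ij′ = proj₂ (B i j) (inj₁ ij)
            i∉0′ : Signed y i
            i∉0′ 0i = [ i∉0 , [ (λ p → a∉0 (blk-sym x a fzero (proj₁ p)))
                              , (λ p → b∉0 (blk-sym x b fzero (proj₁ p))) ]′ ]′ (proj₁ (B fzero i) 0i)
            (f , g) = proj₂ y≈z i j ij′ i∉0′
        in (g , f) ⇔∘ S i j ij i∉0)
  Cover-respʳ-≈ {x} {y} {z} (inj₂ (a , a∉0 , B , S)) y≈z =
    inj₂ (a , a∉0 ,
      (λ i j → proj₁ (≈-sym {y} {z} y≈z) i j ⇔∘ B i j) ,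
      λ i j ij i∉0 a≁i →
        let ij′ = proj₂ (B i j) (inj₁ ij)
            i∉0′ : Signed y i
            i∉0′ 0i = [ i∉0 , (λ p → [ i∉0 , a≁i ]′ (proj₂ p)) ]′ (proj₁ (B fzero i) 0i)
            (f , g) = proj₂ y≈z i j ij′ i∉0′
        in (g , f) ⇔∘ S i j ij i∉0 a≁i)

  Cover⁺-respʳ-≈ : ∀ {x y z : SP} → TransClosure Cover x y → y ≈B z → TransClosure Cover x z
  Cover⁺-respʳ-≈ {x} {y} {z} [ c ]    y≈z = [ Cover-respʳ-≈ {x} {y} {z} c y≈z ]
  Cover⁺-respʳ-≈             (c ∷ cs) y≈z = c ∷ Cover⁺-respʳ-≈ cs y≈z

  -- Joins in Π^B_n, computed by imposing one link at a time

  module _ (x : SP) (p q : E) (s : E → Bool) where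

    Glued : E → E → Set
    Glued i j = SameBlock x i j ⊎ ((SameBlock x p i ⊎ SameBlock x q i) × (SameBlock x p j ⊎ SameBlock x q j))

    glued? : ∀ i j → Dec (Glued i j)
    glued? i j = sameBlock? x i j ⊎-dec
      ((sameBlock? x p i ⊎-dec sameBlock? x q i) ×-dec (sameBlock? x p j ⊎-dec sameBlock? x q j))

    private
      resp : ∀ i j → SameBlock x i j → SameBlock x p i ⊎ SameBlock x q i → SameBlock x p j ⊎ SameBlock x q j
      resp i j ij = map (λ pi → blk-trans x p i j pi ij) (λ qi → blk-trans x q i j qi ij)

    Glued-sym : ∀ i j → Glued i j → Glued j i
    Glued-sym i j (inj₁ ij)        = inj₁ (blk-sym x i j ij)
    Glued-sym i j (inj₂ (pi , pj)) = inj₂ (pj , pi)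

    Glued-trans : ∀ i j l → Glued i j → Glued j l → Glued i l
    Glued-trans i j l (inj₁ ij)       (inj₁ jl)       = inj₁ (blk-trans x i j l ij jl)
    Glued-trans i j l (inj₁ ij)       (inj₂ (j∈ , l∈)) = inj₂ (resp j i (blk-sym x i j ij) j∈ , l∈)
    Glued-trans i j l (inj₂ (i∈ , j∈)) (inj₁ jl)       = inj₂ (i∈ , resp j l jl j∈)
    Glued-trans i j l (inj₂ (i∈ , _)) (inj₂ (_ , l∈)) = inj₂ (i∈ , l∈)

    -- Serves both kinds of cover: with `fzero` for `p` the block of `q` is absorbed into the zero
    -- block. The signs `s` stay open because fusing two signed blocks may require reversing one of
    -- them.
    glue : SP
    glue = record
      { blk       = λ i j → ⌊ glued? i j ⌋
      ; sign      = s
      ; blk-refl  = λ i → fromWitness {a? = glued? i i} (inj₁ (blk-refl x i))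
      ; blk-sym   = λ i j ij → fromWitness {a? = glued? j i} (Glued-sym i j (toWitness {a? = glued? i j} ij))
      ; blk-trans = λ i j l ij jl → fromWitness {a? = glued? i l}
          (Glued-trans i j l (toWitness {a? = glued? i j} ij) (toWitness {a? = glued? j l} jl))
      }

    glue-blk : ∀ i j → Iff (SameBlock glue i j) (Glued i j)
    glue-blk i j = toWitness {a? = glued? i j} , fromWitness {a? = glued? i j}

  Step : SP → SP → Set
  Step x y = x ≡ y ⊎ Cover x y

  Step⇒⊑ : ∀ {x y} → Step x y → x ⊑ y
  Step⇒⊑ (inj₁ refl) = ⊑-refl
  Step⇒⊑ (inj₂ c)    = Cover⇒⊑ c

  -- A succession of such universal steps computes a join; since each step is at most one cover, it
  -- also yields a chain of covers.
  Imposed : SP → E → E → Bool → Set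
  Imposed x i j e = Σ SP λ z → Step x z × Linked z i j e × (∀ w → x ⊑ w → Linked w i j e → z ⊑ w)

  module _ (x : SP) (a : E) (a∉0 : Signed x a) where

    private
      z = glue x fzero a (sign x)
      z-blk = glue-blk x fzero a (sign x)

    -- `forced` isolates what the uses share: a link between the zero block and a signed block, or a
    -- contradictory sign inside a signed block, leaves an upper bound no other choice.
    absorb : ∀ i j e → InZero x i ⊎ SameBlock x a i → InZero x j ⊎ SameBlock x a j →
      (∀ w → x ⊑ w → Linked w i j e → InZero w a) → Imposed x i j e
    absorb i j e i∈ j∈ forced =
      z , inj₂ (inj₂ (a , a∉0 , z-blk , λ _ _ _ _ _ → id , id)) ,
      Linked-zero z i j e (zero∈ i∈) (zero∈ j∈) ,
      λ w x⊑w lw → mk⊑ λ k l kl → least w x⊑w (forced w x⊑w lw) k l (proj₁ (z-blk k l) kl)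
      where
      zero∈ : ∀ {k} → InZero x k ⊎ SameBlock x a k → InZero z k
      zero∈ {k} k∈ = proj₂ (z-blk fzero k) (inj₂ (inj₁ (blk-refl x fzero) , k∈))

      least : ∀ w → x ⊑ w → InZero w a → ∀ k l → Glued x fzero a (sign x) k l → Linked w k l (diff x k l)
      least w x⊑w 0a k l (inj₁ kl) = link x⊑w k l kl
      least w x⊑w 0a k l (inj₂ (k∈ , l∈)) = Linked-zero w k l _ (in0 k k∈) (in0 l l∈)
        where
        in0 : ∀ k → InZero x k ⊎ SameBlock x a k → InZero w k
        in0 k (inj₁ 0k) = block x⊑w fzero k 0k
        in0 k (inj₂ ak) = InZero-resp w a k (block x⊑w a k ak) 0a

  module _ (x : SP) (a b : E) (e : Bool) (a∉0 : Signed x a) (b∉0 : Signed x b) (a≁b : ¬ SameBlock x a b) where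

    private
      -- True exactly when `a` and `b` have the wrong relative sign; the whole block of `b` is then
      -- reversed, which keeps the relative signs inside it.
      flip : Bool
      flip = diff x a b xor e

      s : E → Bool
      s k = if blk x b k then flip xor sign x k else sign x k

      z = glue x a b s
      z-blk = glue-blk x a b s

      s-in : ∀ k → SameBlock x b k → s k ≡ flip xor sign x k
      s-in k bk with blk x b k
      ... | true = refl

      s-out : ∀ k → ¬ SameBlock x b k → s k ≡ sign x k
      s-out k ¬bk with blk x b k
      ... | true  = ⊥-elim (¬bk _)
      ... | false = refl

      xor-shift : ∀ f c d → (f xor c) xor (f xor d) ≡ c xor d
      xor-shift f c d = trans (cong (_xor (f xor d)) (xor-comm f c)) (xor-cocycle c f d)

      diff-old : ∀ k l → SameBlock x k l → diff z k l ≡ diff x k l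
      diff-old k l kl with sameBlock? x b k
      ... | yes bk = trans (cong₂ _xor_ (s-in k bk) (s-in l (blk-trans x b k l bk kl))) (xor-shift flip _ _)
      ... | no ¬bk = cong₂ _xor_ (s-out k ¬bk) (s-out l (λ bl → ¬bk (blk-trans x b l k bl (blk-sym x k l kl))))

      xor-new : ∀ c d e → c xor (((c xor d) xor e) xor d) ≡ e
      xor-new false false false = refl
      xor-new false false true  = refl
      xor-new false true  false = refl
      xor-new false true  true  = refl
      xor-new true  false false = refl
      xor-new true  false true  = refl
      xor-new true  true  false = refl
      xor-new true  true  true  = refl

      diff-new : diff z a b ≡ e
      diff-new = trans (cong₂ _xor_ (s-out a (a≁b ∘ blk-sym x b a)) (s-in b (blk-refl x b)))
                       (xor-new (sign x a) (sign x b) e)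

      crossing : ∀ i j → Iff (Glued x a b s i j)
        (SameBlock x i j ⊎ ((SameBlock x a i × SameBlock x b j) ⊎ (SameBlock x b i × SameBlock x a j)))
      crossing i j = to , from
        where
        to : Glued x a b s i j → _
        to (inj₁ ij)                  = inj₁ ij
        to (inj₂ (inj₁ ai , inj₁ aj)) = inj₁ (blk-trans x i a j (blk-sym x a i ai) aj)
        to (inj₂ (inj₁ ai , inj₂ bj)) = inj₂ (inj₁ (ai , bj))
        to (inj₂ (inj₂ bi , inj₁ aj)) = inj₂ (inj₂ (bi , aj))
        to (inj₂ (inj₂ bi , inj₂ bj)) = inj₁ (blk-trans x i b j (blk-sym x b i bi) bj)

        from : _ → Glued x a b s i j
        from (inj₁ ij)               = inj₁ ij
        from (inj₂ (inj₁ (ai , bj))) = inj₂ (inj₁ ai , inj₂ bj)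
        from (inj₂ (inj₂ (bi , aj))) = inj₂ (inj₂ bi , inj₁ aj)

      z-blk′ = λ i j → z-blk i j ⇔∘ crossing i j

      linkˣ : ∀ w → x ⊑ w → ∀ i j → SameBlock x i j → Linked w i j (diff z i j)
      linkˣ w x⊑w i j ij = subst (Linked w i j) (sym (diff-old i j ij)) (link x⊑w i j ij)

      -- The path `k`, `a`, `b`, `l` uses two old links and the new one, and the relative signs add
      -- up along it.
      via : ∀ w → x ⊑ w → Linked w a b e → ∀ k l → SameBlock x a k → SameBlock x b l → Linked w k l (diff z k l)
      via w x⊑w lw k l ak bl =
        subst (Linked w k l) (trans (cong (diff z k a xor_) (diff-cocycle z a b l)) (diff-cocycle z k a l))
          (Linked-trans w k a l (Linked-sym w a k (subst (Linked w a k) (diff-sym z a k) (linkˣ w x⊑w a k ak)))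
            (Linked-trans w a b l (subst (Linked w a b) (sym diff-new) lw) (linkˣ w x⊑w b l bl)))

      least : ∀ w → x ⊑ w → Linked w a b e → ∀ k l →
        SameBlock x k l ⊎ ((SameBlock x a k × SameBlock x b l) ⊎ (SameBlock x b k × SameBlock x a l)) →
        Linked w k l (diff z k l)
      least w x⊑w lw k l (inj₁ kl)               = linkˣ w x⊑w k l kl
      least w x⊑w lw k l (inj₂ (inj₁ (ak , bl))) = via w x⊑w lw k l ak bl
      least w x⊑w lw k l (inj₂ (inj₂ (bk , al))) =
        subst (Linked w k l) (diff-sym z l k) (Linked-sym w l k (via w x⊑w lw l k al bk))

    fuse : Imposed x a b e
    fuse = z ,
      inj₂ (inj₁ (a , b , a∉0 , b∉0 , a≁b , z-blk′ , λ i j ij _ →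
        xor≡⇒Iff (sign z i) (sign z j) (sign x i) (sign x j) (diff-old i j ij))) ,
      (proj₂ (z-blk′ a b) (inj₂ (inj₁ (blk-refl x a , blk-refl x b))) , λ _ → diff-new) ,
      λ w x⊑w lw → mk⊑ λ k l kl → least w x⊑w lw k l (proj₁ (z-blk′ k l) kl)

  impose : ∀ (x : SP) i j e → Imposed x i j e
  impose x i j e with sameBlock? x fzero i | sameBlock? x fzero j | sameBlock? x i j
  ... | yes 0i | yes 0j | _ = x , inj₁ refl , Linked-zero x i j e 0i 0j , λ _ x⊑w _ → x⊑w
  ... | yes 0i | no j∉0 | _ = absorb x j j∉0 i j e (inj₁ 0i) (inj₂ (blk-refl x j))
        λ w x⊑w lw → InZero-resp w i j (proj₁ lw) (block x⊑w fzero i 0i)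
  ... | no i∉0 | yes 0j | _ = absorb x i i∉0 i j e (inj₂ (blk-refl x i)) (inj₁ 0j)
        λ w x⊑w lw → InZero-resp w j i (blk-sym w i j (proj₁ lw)) (block x⊑w fzero j 0j)
  ... | no i∉0 | no j∉0 | no i≁j = fuse x i j e i∉0 j∉0 i≁j
  ... | no i∉0 | no j∉0 | yes ij with diff x i j ≟ᵇ e
  ...   | yes d≡e = x , inj₁ refl , (ij , λ _ → d≡e) , λ _ x⊑w _ → x⊑w
  -- No signed block holds both relative signs of `i` and `j`, so every upper bound has them in its
  -- zero block.
  ...   | no d≢e  = absorb x i i∉0 i j e (inj₂ (blk-refl x i)) (inj₂ ij)
          λ w x⊑w lw → decidable-stable (sameBlock? w fzero i)
            λ i∉0 → d≢e (trans (sym (proj₂ (link x⊑w i j ij) i∉0)) (proj₂ lw i∉0))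

  Reach : SP → SP → Set
  Reach x y = x ≡ y ⊎ TransClosure Cover x y

  Reach⇒⊑ : ∀ {x y} → Reach x y → x ⊑ y
  Reach⇒⊑ (inj₁ refl) = ⊑-refl
  Reach⇒⊑ (inj₂ cs)   = ≤⇒⊑ (inj₂ cs)

  Step-Reach : ∀ {x y z} → Step x y → Reach y z → Reach x z
  Step-Reach (inj₁ refl) r           = r
  Step-Reach (inj₂ c)    (inj₁ refl) = inj₂ [ c ]
  Step-Reach (inj₂ c)    (inj₂ cs)   = inj₂ (c ∷ cs)

  module _ (y : SP) where

    imposeAll : (ps : List (E × E)) (x : SP) → Σ SP λ z → Reach x z ×
      All (λ (i , j) → SameBlock y i j → Linked z i j (diff y i j)) ps ×
      (∀ w → x ⊑ w → y ⊑ w → z ⊑ w)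
    imposeAll []             x = x , inj₁ refl , [] , λ _ x⊑w _ → x⊑w
    imposeAll ((i , j) ∷ ps) x with sameBlock? y i j
    ... | no i≁j = let (z , r , ls , least) = imposeAll ps x in
                   z , r , (⊥-elim ∘ i≁j) ∷ ls , least
    ... | yes ij =
      let (x′ , st , l , least′) = impose x i j (diff y i j)
          (z , r , ls , least)   = imposeAll ps x′
      in z , Step-Reach st r , (λ _ → Linked-mono (Reach⇒⊑ r) i j l) ∷ ls ,
         λ w x⊑w y⊑w → least w (least′ w x⊑w (link y⊑w i j ij)) y⊑w

  join : ∀ x y → Σ SP λ z → Reach x z × y ⊑ z × (∀ w → x ⊑ w → y ⊑ w → z ⊑ w)
  join x y =
    let (z , r , ls , least) = imposeAll y (cartesianProduct (allFin _) (allFin _)) x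
    in z , r , mk⊑ (λ i j → All.lookup ls (∈-cartesianProduct⁺ (∈-allFin i) (∈-allFin j))) , least

  -- The join of `x` and `y` is then `y` up to `_≈B_`, and its computation from `x` is already a
  -- chain of covers.
  ⊑⇒≤ : ∀ {x y} → x ⊑ y → x ≤B y
  ⊑⇒≤ {x} {y} x⊑y with join x y
  ... | z , r , y⊑z , least with r | ⊑-antisym (least y x⊑y ⊑-refl) y⊑z
  ...   | inj₁ refl | z≈y = inj₁ z≈y
  ...   | inj₂ cs   | z≈y = inj₂ (Cover⁺-respʳ-≈ cs z≈y)

  -- Meets in Π^B_n

  module _ (x y : SP) where

    -- Signs can separate `i` from `j` only if both blocks are signed; a zero block is compatible
    -- with every relative sign.
    Met : E → E → Set
    Met i j = SameBlock x i j × SameBlock y i j × (InZero x i ⊎ InZero y i ⊎ diff x i j ≡ diff y i j)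

    met? : ∀ i j → Dec (Met i j)
    met? i j = sameBlock? x i j ×-dec sameBlock? y i j ×-dec
      (sameBlock? x fzero i ⊎-dec sameBlock? y fzero i ⊎-dec (diff x i j ≟ᵇ diff y i j))

    Met-sym : ∀ i j → Met i j → Met j i
    Met-sym i j (ij , ij′ , c) = blk-sym x i j ij , blk-sym y i j ij′ ,
      map (InZero-resp x i j ij)
          (map (InZero-resp y i j ij′) λ eq → trans (diff-sym x j i) (trans eq (diff-sym y i j))) c

    Met-trans : ∀ i j l → Met i j → Met j l → Met i l
    Met-trans i j l (ij , ij′ , c) (jl , jl′ , d) =
      blk-trans x i j l ij jl , blk-trans y i j l ij′ jl′ , signs c d
      where
      signs : InZero x i ⊎ InZero y i ⊎ diff x i j ≡ diff y i j →
              InZero x j ⊎ InZero y j ⊎ diff x j l ≡ diff y j l →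
              InZero x i ⊎ InZero y i ⊎ diff x i l ≡ diff y i l
      signs (inj₁ 0i)        _                = inj₁ 0i
      signs (inj₂ (inj₁ 0i)) _                = inj₂ (inj₁ 0i)
      signs (inj₂ (inj₂ _))  (inj₁ 0j)        = inj₁ (InZero-resp x j i (blk-sym x i j ij) 0j)
      signs (inj₂ (inj₂ _))  (inj₂ (inj₁ 0j)) = inj₂ (inj₁ (InZero-resp y j i (blk-sym y i j ij′) 0j))
      signs (inj₂ (inj₂ p))  (inj₂ (inj₂ q))  = inj₂ (inj₂
        (trans (sym (diff-cocycle x i j l)) (trans (cong₂ _xor_ p q) (diff-cocycle y i j l))))

    meet : SP
    meet = record
      { blk       = λ i j → ⌊ met? i j ⌋
      -- In the zero block of `x` the signs of `x` mean nothing, so those of `y` decide.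
      ; sign      = λ i → if blk x fzero i then sign y i else sign x i
      ; blk-refl  = λ i → fromWitness {a? = met? i i} (blk-refl x i , blk-refl y i ,
          inj₂ (inj₂ (trans (xor-same (sign x i)) (sym (xor-same (sign y i))))))
      ; blk-sym   = λ i j ij → fromWitness {a? = met? j i} (Met-sym i j (toWitness {a? = met? i j} ij))
      ; blk-trans = λ i j l ij jl → fromWitness {a? = met? i l}
          (Met-trans i j l (toWitness {a? = met? i j} ij) (toWitness {a? = met? j l} jl))
      }

    meet-blk : ∀ i j → Iff (SameBlock meet i j) (Met i j)
    meet-blk i j = toWitness {a? = met? i j} , fromWitness {a? = met? i j}

    private
      sign-in : ∀ i → InZero x i → sign meet i ≡ sign y i
      sign-in i 0i with blk x fzero i
      ... | true = refl

      sign-out : ∀ i → Signed x i → sign meet i ≡ sign x i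
      sign-out i i∉0 with blk x fzero i
      ... | true  = ⊥-elim (i∉0 _)
      ... | false = refl

      diff-in : ∀ i j → SameBlock x i j → InZero x i → diff meet i j ≡ diff y i j
      diff-in i j ij 0i = cong₂ _xor_ (sign-in i 0i) (sign-in j (InZero-resp x i j ij 0i))

      diff-out : ∀ i j → SameBlock x i j → Signed x i → diff meet i j ≡ diff x i j
      diff-out i j ij i∉0 = cong₂ _xor_ (sign-out i i∉0)
        (sign-out j (i∉0 ∘ InZero-resp x j i (blk-sym x i j ij)))

    meet⊑ˡ : meet ⊑ x
    meet⊑ˡ = mk⊑ λ i j ij → let (ij , _) = proj₁ (meet-blk i j) ij in
      ij , λ i∉0 → sym (diff-out i j ij i∉0)

    meet⊑ʳ : meet ⊑ y
    meet⊑ʳ = mk⊑ λ i j ij → go i j (proj₁ (meet-blk i j) ij)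
      where
      go : ∀ i j → Met i j → Linked y i j (diff meet i j)
      go i j (ij , ij′ , c) = ij′ , λ i∉0 → signs i∉0 (sameBlock? x fzero i) c
        where
        signs : Signed y i → Dec (InZero x i) → InZero x i ⊎ InZero y i ⊎ diff x i j ≡ diff y i j →
          diff y i j ≡ diff meet i j
        signs _   (yes 0i)  _                = sym (diff-in i j ij 0i)
        signs _   (no i∉0ˣ) (inj₁ 0i)        = ⊥-elim (i∉0ˣ 0i)
        signs i∉0 (no _)    (inj₂ (inj₁ 0i)) = ⊥-elim (i∉0 0i)
        signs _   (no i∉0ˣ) (inj₂ (inj₂ eq)) = trans (sym eq) (sym (diff-out i j ij i∉0ˣ))

    meet-greatest : ∀ {w} → w ⊑ x → w ⊑ y → w ⊑ meet
    meet-greatest {w} w⊑x w⊑y = mk⊑ λ i j ij → go i j ij (sameBlock? x fzero i) (sameBlock? y fzero i)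
      where
      go : ∀ i j → SameBlock w i j → Dec (InZero x i) → Dec (InZero y i) → Linked meet i j (diff w i j)
      go i j ij 0i? 0i?′ with link w⊑x i j ij | link w⊑y i j ij
      go i j ij (yes 0i) (yes 0i′) | ijˣ , s | ijʸ , t =
        proj₂ (meet-blk i j) (ijˣ , ijʸ , inj₁ 0i) ,
        λ i∉0 → ⊥-elim (i∉0 (proj₂ (meet-blk fzero i) (0i , 0i′ , inj₁ (blk-refl x fzero))))
      go i j ij (yes 0i) (no i∉0′) | ijˣ , s | ijʸ , t =
        proj₂ (meet-blk i j) (ijˣ , ijʸ , inj₁ 0i) ,
        λ _ → trans (diff-in i j ijˣ 0i) (t i∉0′)
      go i j ij (no i∉0) (yes 0i′) | ijˣ , s | ijʸ , t =
        proj₂ (meet-blk i j) (ijˣ , ijʸ , inj₂ (inj₁ 0i′)) ,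
        λ _ → trans (diff-out i j ijˣ i∉0) (s i∉0)
      go i j ij (no i∉0) (no i∉0′) | ijˣ , s | ijʸ , t =
        proj₂ (meet-blk i j) (ijˣ , ijʸ , inj₂ (inj₂ (trans (s i∉0) (sym (t i∉0′))))) ,
        λ _ → trans (diff-out i j ijˣ i∉0) (s i∉0)

  -- Block sizes

  blockSize-mono : ∀ (x y : SP) i j → (∀ l → SameBlock x i l → SameBlock y j l) → blockSize x i ≤ blockSize y j
  blockSize-mono x y i j f = length-filterᵇ-mono {p = blk x i} {q = blk y j} {allFin (suc n)} (All.tabulate λ {l} _ → f l)

  blockSize-cong : ∀ (x : SP) i j → SameBlock x i j → blockSize x i ≡ blockSize x j
  blockSize-cong x i j ij = ≤-antisym
    (blockSize-mono x x i j λ l → blk-trans x j i l (blk-sym x i j ij))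
    (blockSize-mono x x j i λ l → blk-trans x i j l ij)

  block-⊆-size : ∀ (x y : SP) i j → (∀ l → SameBlock x i l → SameBlock y j l) → blockSize y j ≤ blockSize x i →
    ∀ l → SameBlock y j l → SameBlock x i l
  block-⊆-size x y i j f size l jl = decidable-stable (sameBlock? x i l) λ i≁l →
    <⇒≱ (length-filterᵇ-strict {p = blk x i} {q = blk y j} (All.tabulate λ {l} _ → f l)
           (lose (∈-allFin l) (i≁l , jl))) size

  blockSize-insert : ∀ (x y : SP) i j a → (∀ l → SameBlock x i l → l ≡ a ⊎ SameBlock y j l) →
    blockSize x i ≤ suc (blockSize y j)
  blockSize-insert x y i j a = length-filterᵇ-insert {p = blk x i} {q = blk y j} a (allFin⁺ (suc n))

  -- Admissible block sizes and pruning

  module _ (k h : ℕ) (h<k : h < k) where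

    -- The least size allowed for a nontrivial block. A single function lets signed and zero blocks
    -- be compared uniformly; the zero block counts 0 itself, hence `suc h`.
    threshold : SP → E → ℕ
    threshold x i = if blk x fzero i then suc h else k

    threshold-zero : ∀ (x : SP) i → InZero x i → threshold x i ≡ suc h
    threshold-zero x i 0i with blk x fzero i
    ... | true = refl

    threshold-signed : ∀ (x : SP) i → Signed x i → threshold x i ≡ k
    threshold-signed x i i∉0 with blk x fzero i
    ... | true  = ⊥-elim (i∉0 _)
    ... | false = refl

    -- Here `h < k` enters: passing to a zero block never raises the requirement.
    threshold-anti : ∀ (x y : SP) i j → (InZero x i → InZero y j) → threshold y j ≤ threshold x i
    threshold-anti x y i j f with blk x fzero i | blk y fzero j
    ... | false | false = ≤-refl
    ... | false | true  = h<k
    ... | true  | true  = ≤-refl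
    ... | true  | false = ⊥-elim (f _)

    Large : SP → E → Set
    Large x i = threshold x i ≤ blockSize x i

    Large-mono : ∀ (x y : SP) i → (∀ l → SameBlock x i l → SameBlock y i l) → Large x i → Large y i
    Large-mono x y i f large = ≤-trans
      (threshold-anti x y i i λ 0i → blk-sym y i fzero (f fzero (blk-sym x fzero i 0i)))
      (≤-trans large (blockSize-mono x y i i f))

    Large-resp : ∀ (x : SP) i j → SameBlock x i j → Large x i → Large x j
    Large-resp x i j ij large = ≤-trans
      (threshold-anti x x i j (InZero-resp x i j ij)) (≤-trans large (≤-reflexive (blockSize-cong x i j ij)))

    Admissible : SP → Set
    Admissible = InΠB n k h

    -- Together with `Large⇒Admissible` this gives one criterion for both kinds of block: whenever
    -- an element has a companion, its block is `Large`.
    Admissible⇒Large : ∀ x → Admissible x → ∀ i j → SameBlock x i j → i ≢ j → Large x i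
    Admissible⇒Large x (signed , zer) i j ij i≢j with sameBlock? x fzero i
    ... | no i∉0 with signed i i∉0
    ...   | inj₁ single = ⊥-elim (i≢j (sym (single j ij)))
    ...   | inj₂ k≤     = ≤-trans (≤-reflexive (threshold-signed x i i∉0)) k≤
    Admissible⇒Large x (signed , zer) i j ij i≢j | yes 0i with zer
    ...   | inj₁ single = ⊥-elim (i≢j (trans (single i 0i) (sym (single j (InZero-resp x i j ij 0i)))))
    ...   | inj₂ h<     = ≤-trans (≤-reflexive (threshold-zero x i 0i))
                            (≤-trans h< (≤-reflexive (blockSize-cong x fzero i 0i)))

    Singleton : SP → E → Set
    Singleton x i = ∀ j → SameBlock x i j → j ≡ i

    singletonOr : ∀ x i → Singleton x i ⊎ ∃ λ j → SameBlock x i j × i ≢ j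
    singletonOr x i with any? (λ j → sameBlock? x i j ×-dec ¬? (i ≟ j))
    ... | yes other = inj₂ other
    ... | no none   = inj₁ λ j ij → sym (decidable-stable (i ≟ j) λ i≢j → none (j , ij , i≢j))

    Large⇒Admissible : ∀ {x} → (∀ i j → SameBlock x i j → i ≢ j → Large x i) → Admissible x
    Large⇒Admissible {x} large =
      (λ i i∉0 → map id (λ (j , ij , i≢j) →
        ≤-trans (≤-reflexive (sym (threshold-signed x i i∉0))) (large i j ij i≢j)) (singletonOr x i)) ,
      map id (λ (j , 0j , 0≢j) →
        ≤-trans (≤-reflexive (sym (threshold-zero x fzero (blk-refl x fzero)))) (large fzero j 0j 0≢j))
        (singletonOr x fzero)

    module _ (x : SP) where

      Kept : E → E → Set
      Kept i j = i ≡ j ⊎ (SameBlock x i j × Large x i)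

      kept? : ∀ i j → Dec (Kept i j)
      kept? i j = (i ≟ j) ⊎-dec (sameBlock? x i j ×-dec (threshold x i ≤? blockSize x i))

      Kept-sym : ∀ i j → Kept i j → Kept j i
      Kept-sym i j (inj₁ refl)     = inj₁ refl
      Kept-sym i j (inj₂ (ij , l)) = inj₂ (blk-sym x i j ij , Large-resp x i j ij l)

      Kept-trans : ∀ i j l → Kept i j → Kept j l → Kept i l
      Kept-trans i j l (inj₁ refl)      jl               = jl
      Kept-trans i j l (inj₂ p)         (inj₁ refl)      = inj₂ p
      Kept-trans i j l (inj₂ (ij , li)) (inj₂ (jl , _)) = inj₂ (blk-trans x i j l ij jl , li)

      -- The signs can be copied: a signed block of the result is an old signed block or a
      -- singleton, whose relative signs are trivial.
      prune : SP
      prune = record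
        { blk       = λ i j → ⌊ kept? i j ⌋
        ; sign      = sign x
        ; blk-refl  = λ i → fromWitness {a? = kept? i i} (inj₁ refl)
        ; blk-sym   = λ i j ij → fromWitness {a? = kept? j i} (Kept-sym i j (toWitness {a? = kept? i j} ij))
        ; blk-trans = λ i j l ij jl → fromWitness {a? = kept? i l}
            (Kept-trans i j l (toWitness {a? = kept? i j} ij) (toWitness {a? = kept? j l} jl))
        }

      prune-blk : ∀ i j → Iff (SameBlock prune i j) (Kept i j)
      prune-blk i j = toWitness {a? = kept? i j} , fromWitness {a? = kept? i j}

      prune-admissible : Admissible prune
      prune-admissible = Large⇒Admissible {prune} λ i j ij → go i j (proj₁ (prune-blk i j) ij)
        where
        go : ∀ i j → Kept i j → i ≢ j → Large prune i
        go i j (inj₁ i≡j)     i≢j = ⊥-elim (i≢j i≡j)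
        go i j (inj₂ (_ , l)) _   = Large-mono x prune i (λ m im → proj₂ (prune-blk i m) (inj₂ (im , l))) l

      prune⊑ : prune ⊑ x
      prune⊑ = mk⊑ λ i j ij → [ (λ { refl → blk-refl x i }) , proj₁ ]′ (proj₁ (prune-blk i j) ij) , λ _ → refl

      -- A nontrivial block of an admissible `w` is large, so by `Large-mono` the block of `x`
      -- around it is large too and is not broken up.
      prune-greatest : ∀ {w} → Admissible w → w ⊑ x → w ⊑ prune
      prune-greatest {w} adm w⊑x = mk⊑ λ i j ij →
        proj₂ (prune-blk i j) (kept i j ij (i ≟ j)) ,
        λ i∉0 → signs i j ij i∉0 (i ≟ j)
        where
        large : ∀ i j → SameBlock w i j → i ≢ j → Large x i
        large i j ij i≢j = Large-mono w x i (block w⊑x i) (Admissible⇒Large w adm i j ij i≢j)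

        kept : ∀ i j → SameBlock w i j → Dec (i ≡ j) → Kept i j
        kept i j ij (yes i≡j) = inj₁ i≡j
        kept i j ij (no i≢j)  = inj₂ (block w⊑x i j ij , large i j ij i≢j)

        signs : ∀ i j → SameBlock w i j → Signed prune i → Dec (i ≡ j) → diff x i j ≡ diff w i j
        signs i j ij i∉0 (yes refl) = trans (xor-same (sign x i)) (sym (xor-same (sign w i)))
        -- Were `i` in the zero block of `x`, that large block would be kept and `i` would not be
        -- signed after pruning.
        signs i j ij i∉0 (no i≢j)   = proj₂ (link w⊑x i j ij) λ 0i → i∉0
          (blk-sym prune i fzero (proj₂ (prune-blk i fzero) (inj₂ (blk-sym x fzero i 0i , large i j ij i≢j))))

    -- The lattice of admissible partitions

    meetS : SP → SP → SP
    meetS x y = prune (meet x y)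

    meetS⊑ˡ : ∀ x y → meetS x y ⊑ x
    meetS⊑ˡ x y = ⊑-trans (prune⊑ (meet x y)) (meet⊑ˡ x y)

    meetS⊑ʳ : ∀ x y → meetS x y ⊑ y
    meetS⊑ʳ x y = ⊑-trans (prune⊑ (meet x y)) (meet⊑ʳ x y)

    meetS-greatest : ∀ x y {w} → Admissible w → w ⊑ x → w ⊑ y → w ⊑ meetS x y
    meetS-greatest x y adm w⊑x w⊑y = prune-greatest (meet x y) adm (meet-greatest x y w⊑x w⊑y)

    open Order (_≈B_ {n}) (_≤B_ {n}) hiding (_<_)

    isLattice : IsLatticeOn Admissible
    isLattice x y admx admy = joins , meets
      where
      joins : ∃ (IsJoinIn Admissible x y)
      joins = let (z , r , y⊑z , least) = join x y in
        -- Pruning the join keeps it above `x` and `y`, because both are admissible.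
        prune z , prune-admissible z ,
        ⊑⇒≤ (prune-greatest z admx (Reach⇒⊑ r)) , ⊑⇒≤ (prune-greatest z admy y⊑z) ,
        λ w _ x≤w y≤w → ⊑⇒≤ (⊑-trans (prune⊑ z) (least w (≤⇒⊑ x≤w) (≤⇒⊑ y≤w)))

      meets : ∃ (IsMeetIn Admissible x y)
      meets = meetS x y , prune-admissible (meet x y) , ⊑⇒≤ (meetS⊑ˡ x y) , ⊑⇒≤ (meetS⊑ʳ x y) ,
        λ w adm w≤x w≤y → ⊑⇒≤ (meetS-greatest x y adm (≤⇒⊑ w≤x) (≤⇒⊑ w≤y))

    -- The modular coatom

    -- `b` witnesses that the block A of `a` is a proper part of its block in `v`. In `minimal` the
    -- element 0 is exempt: even as a singleton, its block is not signed and cannot serve as A.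
    record Splitter (u v : SP) : Set where
      field
        a        : E
        a-signed : Signed u a
        b        : E
        a~b      : SameBlock v a b
        a≁b      : ¬ SameBlock u a b
        minimal  : Singleton u a ⊎ (∀ c → SameBlock v a c → c ≢ fzero → ¬ Singleton u c)

    singleton? : ∀ (x : SP) i → Dec (Singleton x i)
    singleton? x i with singletonOr x i
    ... | inj₁ single         = yes single
    ... | inj₂ (j , ij , i≢j) = no λ single → i≢j (sym (single j ij))

    -- Since `u` separates `a` from `b`, the block of `c` in `u` misses one of them.
    partner : ∀ (u v : SP) a b c → SameBlock v a b → ¬ SameBlock u a b → SameBlock v a c →
      ∃ λ d → SameBlock v c d × ¬ SameBlock u c d
    partner u v a b c ab a≁b ac with sameBlock? u c a
    ... | no c≁a = a , blk-sym v a c ac , c≁a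
    ... | yes ca = b , blk-trans v c a b (blk-sym v a c ac) ab ,
                   λ cb → a≁b (blk-trans u a c b (blk-sym u c a ca) cb)

    splitter-at : ∀ {u v} a b → Signed u a → SameBlock v a b → ¬ SameBlock u a b → Splitter u v
    splitter-at {u} {v} a b a∉0 ab a≁b
      with any? (λ c → sameBlock? v a c ×-dec ¬? (c ≟ fzero) ×-dec singleton? u c)
    ... | no none = record
      { a = a ; a-signed = a∉0 ; b = b ; a~b = ab ; a≁b = a≁b
      ; minimal = inj₂ λ c ac c≢0 single → none (c , ac , c≢0 , single) }
    ... | yes (c , ac , c≢0 , single) = let (b′ , cb′ , c≁b′) = partner u v a b c ab a≁b ac in record
      { a = c ; a-signed = λ 0c → c≢0 (sym (single fzero (blk-sym u fzero c 0c)))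
      ; b = b′ ; a~b = cb′ ; a≁b = c≁b′ ; minimal = inj₁ single }

    -- Signs agree already by `x ⊑ y`, so the proof that `z` equals `y` can be carried out on blocks
    -- alone.
    ⊑-from-blocks : ∀ {x y} → x ⊑ y → (∀ i j → SameBlock y i j → SameBlock x i j) → y ⊑ x
    ⊑-from-blocks x⊑y back = mk⊑ λ i j ij → back i j ij ,
      λ i∉0 → sym (proj₂ (link x⊑y i j (back i j ij)) (i∉0 ∘ back fzero i))

    splitter : ∀ {u v} → u ⊑ v → ¬ (u ≈B v) → Splitter u v
    splitter {u} {v} u⊑v u≉v with any? (λ i → any? (λ j → sameBlock? v i j ×-dec ¬? (sameBlock? u i j)))
    ... | no none = ⊥-elim (u≉v (⊑-antisym u⊑v (⊑-from-blocks u⊑v λ i j ij →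
            decidable-stable (sameBlock? u i j) λ i≁j → none (i , j , ij , i≁j))))
    ... | yes (i , j , ij , i≁j) with sameBlock? u fzero i
    ...   | no i∉0 = splitter-at i j i∉0 ij i≁j
    -- Two separated elements cannot both lie in the zero block of `u`, so `j` takes the place of
    -- `i`.
    ...   | yes 0i = splitter-at j i (λ 0j → i≁j (InZero-SameBlock u i j 0i 0j))
                       (blk-sym v i j ij) (i≁j ∘ blk-sym u j i)

    module _ {u v : SP} (admu : Admissible u) (admv : Admissible v) (u⊑v : u ⊑ v) (S : Splitter u v) where

      open Splitter S

      -- Comparing membership in A leaves two blocks; 0 is outside A, so the complement is the zero
      -- block and A is signed, with its signs from `u`.
      p : SP
      p = record
        { blk       = λ i j → ⌊ blk u a i ≟ᵇ blk u a j ⌋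
        ; sign      = sign u
        ; blk-refl  = λ i → fromWitness {a? = blk u a i ≟ᵇ blk u a i} refl
        ; blk-sym   = λ i j ij → fromWitness {a? = blk u a j ≟ᵇ blk u a i}
                        (sym (toWitness {a? = blk u a i ≟ᵇ blk u a j} ij))
        ; blk-trans = λ i j l ij jl → fromWitness {a? = blk u a i ≟ᵇ blk u a l}
                        (trans (toWitness {a? = blk u a i ≟ᵇ blk u a j} ij) (toWitness {a? = blk u a j ≟ᵇ blk u a l} jl))
        }

      p-intro : ∀ i j → (SameBlock u a i → SameBlock u a j) → (SameBlock u a j → SameBlock u a i) → SameBlock p i j
      p-intro i j f g with blk u a i | blk u a j
      ... | false | false = _
      ... | false | true  = ⊥-elim (g _)
      ... | true  | false = ⊥-elim (f _)
      ... | true  | true  = _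

      p-elim : ∀ i j → SameBlock p i j → SameBlock u a i → SameBlock u a j
      p-elim i j ij ai with blk u a i | blk u a j
      ... | true | true = _

      outside : ∀ i j → ¬ SameBlock u a i → ¬ SameBlock u a j → SameBlock p i j
      outside i j a≁i a≁j = p-intro i j (⊥-elim ∘ a≁i) (⊥-elim ∘ a≁j)

      a≁0 : ¬ SameBlock u a fzero
      a≁0 = a-signed ∘ blk-sym u a fzero

      -- A is still a whole block of `z`, so all other blocks fit into the zero block of `p`. If A
      -- were not signed in `z` it would contain 0; hence it keeps its signs from `u`.
      ⊑p : ∀ {z} → u ⊑ z → (∀ c → SameBlock z a c → SameBlock u a c) → z ⊑ p
      ⊑p {z} u⊑z closed = mk⊑ λ i j ij →
        p-intro i j (stay i j ij) (stay j i (blk-sym z i j ij)) , λ i∉0 →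
          let ai = decidable-stable (sameBlock? u a i) (i∉0 ∘ outside fzero i a≁0)
          in sym (proj₂ (link u⊑z i j (blk-trans u i a j (blk-sym u a i ai) (stay i j ij ai)))
               λ 0i → a≁0 (closed fzero (blk-trans z a i fzero (block u⊑z a i ai) (blk-sym z fzero i 0i))))
        where
        stay : ∀ i j → SameBlock z i j → SameBlock u a i → SameBlock u a j
        stay i j ij ai = closed j (blk-trans z a i j (block u⊑z a i ai) ij)

      u⊑p : u ⊑ p
      u⊑p = ⊑p ⊑-refl λ _ → id

      ⊑p? : ∀ z → u ⊑ z → z ⊑ p ⊎ ∃ λ c → SameBlock z a c × ¬ SameBlock u a c
      ⊑p? z u⊑z with any? (λ c → sameBlock? z a c ×-dec ¬? (sameBlock? u a c))
      ... | yes escape = inj₂ escape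
      ... | no none    = inj₁ (⊑p u⊑z λ c ac → decidable-stable (sameBlock? u a c) λ a≁c → none (c , ac , a≁c))

      -- The covering property

      module _ {y z : SP} (admy : Admissible y) (admz : Admissible z)
               (u⊑z : u ⊑ z) (z⊑y : z ⊑ y) (y⊑v : y ⊑ v) (w⊑z : meetS y p ⊑ z)
               (c : E) (ac : SameBlock z a c) (a≁c : ¬ SameBlock u a c) where

        private
          d = meet y p

          -- Elements outside A share the zero block of `p`, which imposes no sign condition, so `d`
          -- agrees with `y` there.
          d-intro : ∀ i j → ¬ SameBlock u a i → ¬ SameBlock u a j → SameBlock y i j → SameBlock d i j
          d-intro i j a≁i a≁j ij = proj₂ (meet-blk y p i j)
            (ij , outside i j a≁i a≁j , inj₂ (inj₁ (outside fzero i a≁0 a≁i)))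

          kept⇒z : ∀ i j → SameBlock d i j → Large d i → SameBlock z i j
          kept⇒z i j ij large = block w⊑z i j (proj₂ (prune-blk d i j) (inj₂ (ij , large)))

          u⊑y = ⊑-trans u⊑z z⊑y
          u⊑d = meet-greatest y p u⊑y u⊑p

          acʸ : SameBlock y a c
          acʸ = block z⊑y a c ac

          a≢c : a ≢ c
          a≢c refl = a≁c (blk-refl u a)

          nonsingleton⇒Large : ∀ i → ¬ Singleton u i → Large d i
          nonsingleton⇒Large i ns with singletonOr u i
          ... | inj₁ single         = ⊥-elim (ns single)
          ... | inj₂ (j , ij , i≢j) = Large-mono u d i (block u⊑d i) (Admissible⇒Large u admu i j ij i≢j)

          module _ (i : E) (ai : SameBlock y a i) (a≁i : ¬ SameBlock u a i) where

            ic : SameBlock d i c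
            ic = d-intro i c a≁i a≁c (blk-trans y i a c (blk-sym y a i ai) acʸ)

            -- The block C ∖ A of `d` survives pruning, hence lies in one block of `z`; it contains
            -- `c`, which `z` joins to `a`.
            large⇒ : Large d i → SameBlock z a i
            large⇒ large = blk-trans z a c i ac (blk-sym z i c (kept⇒z i c ic large))

            -- C = {a} ∪ (C ∖ {a}) and C ∖ {a} is too small, so the admissible
            -- z-block of a, which lies inside C, must be all of C.
            small⇒ : Singleton u a → ¬ Large d i → SameBlock z a i
            small⇒ single ¬large = block-⊆-size z y a a (block z⊑y a)
              (≤-trans (blockSize-insert y d a i a cover)
                (≤-trans (≰⇒> ¬large)
                  (≤-trans (threshold-anti z d a i zero⇒) (Admissible⇒Large z admz a c ac a≢c)))) i ai
              where
              cover : ∀ l → SameBlock y a l → l ≡ a ⊎ SameBlock d i l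
              cover l al with sameBlock? u a l
              ... | yes al′ = inj₁ (single l al′)
              ... | no a≁l  = inj₂ (d-intro i l a≁i a≁l (blk-trans y i a l (blk-sym y a i ai) al))

              -- If `z` puts `a` into its zero block, then 0 lies in C ∖ {a}, so the lower
              -- requirement `suc h` applies to both blocks.
              zero⇒ : InZero z a → InZero d i
              zero⇒ 0a = d-intro fzero i a≁0 a≁i (InZero-resp y a i ai (block z⊑y fzero a 0a))

            captured : SameBlock z a i
            captured with threshold d i ≤? blockSize d i
            ... | yes large = large⇒ large
            ... | no ¬large with minimal
            ...   | inj₁ single = small⇒ single ¬large
            -- Every nonzero element of C now has a nontrivial block in `u`, so a nonzero `i` or `c`
            -- would make C ∖ A large. If both are 0, the goal is `ac` itself.
            ...   | inj₂ none with i ≟ fzero | c ≟ fzero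
            ...     | no i≢0   | _        = ⊥-elim (¬large (nonsingleton⇒Large i (none i (block y⊑v a i ai) i≢0)))
            ...     | yes refl | yes refl = ac
            ...     | yes refl | no c≢0   = ⊥-elim (¬large (Large-resp d c i (blk-sym d i c ic)
                        (nonsingleton⇒Large c (none c (block y⊑v a c acʸ) c≢0))))

          joined : ∀ i → SameBlock y a i → SameBlock z a i
          joined i ai with sameBlock? u a i
          ... | yes ai′ = block u⊑z a i ai′
          ... | no a≁i  = captured i ai a≁i

          blocks : ∀ i j → SameBlock y i j → SameBlock z i j
          blocks i j ij with sameBlock? y a i | i ≟ j
          ... | yes ai | _ = blk-trans z i a j (blk-sym z a i (joined i ai)) (joined j (blk-trans y a i j ai ij))
          ... | no _   | yes refl = blk-refl z i
          -- A nontrivial block of `y` other than C misses A, so it is a block of `d`, large by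
          -- admissibility of `y`, and survives pruning.
          ... | no a≁i | no i≢j = kept⇒z i j (same j ij)
                  (Large-mono y d i same (Admissible⇒Large y admy i j ij i≢j))
            where
            same : ∀ l → SameBlock y i l → SameBlock d i l
            same l il = d-intro i l (a≁i ∘ block u⊑y a i)
              (λ al → a≁i (blk-trans y a l i (block u⊑y a l al) (blk-sym y i l il))) il

        -- Used twice: with `v` for `y` it makes `m` a coatom, and for general `y` it drives
        -- left-modularity.
        no-intermediate : y ⊑ z
        no-intermediate = ⊑-from-blocks z⊑y blocks

      -- The coatom and its left-modularity

      m : SP
      m = meetS v p

      m∈ : Interval Admissible u v m
      m∈ = prune-admissible (meet v p) , ⊑⇒≤ (meetS-greatest v p admu u⊑v u⊑p) , ⊑⇒≤ (meetS⊑ˡ v p)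

      ⊑m : ∀ {x} → Interval Admissible u v x → x ⊑ p → x ⊑ m
      ⊑m (admx , _ , x≤v) x⊑p = meetS-greatest v p admx (≤⇒⊑ x≤v) x⊑p

      isCoatom : IsCoatomOf Admissible u v m
      isCoatom = m∈ , (⊑⇒≤ (meetS⊑ˡ v p) , m≉v) , maximal
        where
        m≉v : ¬ (m ≈B v)
        m≉v m≈v = a≁b (p-elim a b (block (⊑-trans (≈⇒⊑ {v} {m} (≈-sym {m} {v} m≈v)) (meetS⊑ʳ v p)) a b a~b) (blk-refl u a))

        maximal : ∀ w → Interval Admissible u v w → m ≤B w → (w ≈B m) ⊎ (w ≈B v)
        maximal w w∈@(admw , u≤w , w≤v) m≤w =
          [ (λ w⊑p → inj₁ (⊑-antisym (⊑m w∈ w⊑p) (≤⇒⊑ m≤w)))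
          , (λ (c , ac , a≁c) → inj₂ (⊑-antisym (≤⇒⊑ w≤v)
               (no-intermediate admv admw (≤⇒⊑ u≤w) (≤⇒⊑ w≤v) ⊑-refl (≤⇒⊑ m≤w) c ac a≁c)))
          ]′ (⊑p? w (≤⇒⊑ u≤w))

      -- Here `j` = x ∨ m, `e` = j ∧ y, `f` = m ∧ y and `g` = x ∨ f; `g` ≤ `e` holds in any lattice.
      -- If `x` ≤ `m`, then `j` = `m` and `e` = `f` ≤ `g`. Otherwise `x`, and with it `g`, joins A
      -- to an outside element, and the covering property gives `g` = `y`.
      isLeftModular : IsLeftModularIn (Interval Admissible u v) m
      isLeftModular x y x∈@(admx , u≤x , x≤v) y∈@(admy , u≤y , y≤v) (x≤y , _) j e f g
        (j∈ , x≤j , m≤j , j-least) (e∈ , e≤j , e≤y , e-greatest)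
        (f∈ , f≤m , f≤y , f-greatest) (g∈ , x≤g , f≤g , g-least) = ⊑-antisym e⊑g g⊑e
        where
        g⊑e : g ⊑ e
        g⊑e = ≤⇒⊑ (g-least e e∈ (e-greatest x x∈ x≤j x≤y)
          (e-greatest f f∈ (⊑⇒≤ (⊑-trans (≤⇒⊑ f≤m) (≤⇒⊑ m≤j))) f≤y))

        w = meetS y p

        w∈ : Interval Admissible u v w
        w∈ = prune-admissible (meet y p) , ⊑⇒≤ (meetS-greatest y p admu (≤⇒⊑ u≤y) u⊑p) ,
             ⊑⇒≤ (⊑-trans (meetS⊑ˡ y p) (≤⇒⊑ y≤v))

        w⊑g : w ⊑ g
        -- `w` lies in the interval and below both `m` and `y`, hence below their meet `f`.
        w⊑g = ⊑-trans (≤⇒⊑ (f-greatest w w∈ (⊑⇒≤ (⊑m w∈ (meetS⊑ʳ y p))) (⊑⇒≤ (meetS⊑ˡ y p)))) (≤⇒⊑ f≤g)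

        e⊑g : e ⊑ g
        e⊑g =
          [ (λ x⊑p → ⊑-trans (≤⇒⊑ (f-greatest e e∈ (⊑⇒≤ (⊑-trans (≤⇒⊑ e≤j)
               (≤⇒⊑ (j-least m m∈ (⊑⇒≤ (⊑m x∈ x⊑p)) (⊑⇒≤ ⊑-refl))))) e≤y)) (≤⇒⊑ f≤g))
          , (λ (c , ac , a≁c) → ⊑-trans (≤⇒⊑ e≤y)
               (no-intermediate admy (proj₁ g∈) (⊑-trans (≤⇒⊑ u≤x) (≤⇒⊑ x≤g)) (≤⇒⊑ (g-least y y∈ x≤y f≤y)) (≤⇒⊑ y≤v)
                 w⊑g c (block (≤⇒⊑ x≤g) a c ac) a≁c))
          ]′ (⊑p? x (≤⇒⊑ u≤x))

    isComodernistic : IsComodernistic Admissible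
    isComodernistic u v admu admv (u≤v , u≉v) =
      let u⊑v = ≤⇒⊑ u≤v ; S = splitter u⊑v u≉v
      in m admu admv u⊑v S , isCoatom admu admv u⊑v S , isLeftModular admu admv u⊑v S

theorem6p2 : ∀ (n k h : ℕ) → 1 ≤ h → h < k → k ≤ n → ComodernisticLatticeΠB n k h
theorem6p2 n k h _ h<k _ = isLattice k h h<k , isComodernistic k h h<k
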